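{- Let $r\ge 2$ and $d\ge 1$ be integers, let $n=(r-1)(d+1)+1$, and let $X=\{a_1,\ldots,a_n\}\subset \mathbb{R}^d$ be a set of $n$ points. Then $X$ is $r$-divisible.
   Context: A finite set $X\subset\mathbb{R}^d$ is called $r$-divisible if there is a partition of $X$ into $r$ parts $X_1,\ldots,X_r$ (pairwise disjoint, with union $X$) such that $\bigcap_{p=1}^r \mathrm{conv}\, X_p\neq\emptyset$, where $\mathrm{conv}$ denotes the convex hull. -}

module Defs where

open import Algebra.Bundles using (CommutativeRing)
open import Algebra.Core using (Op₁; Op₂)
open import Algebra.Definitions using (Invertible)
open import Algebra.Definitions.RawMonoid using (sum)
open import Algebra.Structures using (IsCommutativeRing)
open import Data.Fin.Base using (Fin)
open import Data.Nat.Base using (ℕ)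
open import Data.Product.Base using (_×_; ∃-syntax; Σ-syntax)
open import Data.Vec.Functional using (Vector)
open import Data.Vec.Functional.Relation.Binary.Pointwise using (Pointwise)
open import Level using (Level; _⊔_) renaming (suc to lsuc)
open import Relation.Binary.Core using (Rel)
open import Relation.Binary.Definitions using (_Respects_)
open import Relation.Binary.PropositionalEquality.Core using (_≢_)
open import Relation.Binary.Structures using (IsDecTotalOrder)
open import Relation.Nullary.Negation using (¬_)
open import Relation.Unary using (Pred; _∈_; _≐_; _⊥_; ⋃; ⋂; Satisfiable)

-- The real numbers of classical mathematics, given by the axioms that
-- determine them up to isomorphism: a Dedekind-complete ordered field.
-- As classically, order and equality are decidable (trichotomy), so the
-- reals of constructive analysis are not meant here.
record RealNumbers (c ℓ₁ ℓ₂ : Level) : Set (lsuc (c ⊔ ℓ₁ ⊔ ℓ₂)) where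
  infix  8 -_
  infixl 7 _*_
  infixl 6 _+_
  infix  4 _≈_ _≤_

  field
    Carrier           : Set c
    _≈_               : Rel Carrier ℓ₁
    _≤_               : Rel Carrier ℓ₂
    _+_ _*_           : Op₂ Carrier
    -_                : Op₁ Carrier
    0# 1#             : Carrier
    isCommutativeRing : IsCommutativeRing _≈_ _+_ _*_ -_ 0# 1#
    0≉1               : ¬ (0# ≈ 1#)
    invertible        : ∀ x → ¬ (x ≈ 0#) → Invertible _≈_ 1# _*_ x
    isDecTotalOrder   : IsDecTotalOrder _≈_ _≤_
    +-monoʳ-≤         : ∀ x {y z} → y ≤ z → x + y ≤ x + z
    *-nonNegative     : ∀ {x y} → 0# ≤ x → 0# ≤ y → 0# ≤ x * y

  IsUpperBound : Pred Carrier (c ⊔ ℓ₁ ⊔ ℓ₂) → Carrier → Set (c ⊔ ℓ₁ ⊔ ℓ₂)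
  IsUpperBound S b = ∀ x → x ∈ S → x ≤ b

  field
    supremum : (S : Pred Carrier (c ⊔ ℓ₁ ⊔ ℓ₂)) →
               Satisfiable S → Satisfiable (IsUpperBound S) →
               ∃[ s ] IsUpperBound S s × (∀ b → IsUpperBound S b → s ≤ b)

  commutativeRing : CommutativeRing c ℓ₁
  commutativeRing = record { isCommutativeRing = isCommutativeRing }

  open CommutativeRing commutativeRing public using (+-rawMonoid)

module Euclidean {c ℓ₁ ℓ₂ : Level} (ℝ : RealNumbers c ℓ₁ ℓ₂) where
  open RealNumbers ℝ

  infix 4 _≋_

  Point : ℕ → Set c
  Point d = Vector Carrier d

  _≋_ : {d : ℕ} → Rel (Point d) ℓ₁
  _≋_ = Pointwise _≈_

  Range : {d n : ℕ} → (Fin n → Point d) → Pred (Point d) ℓ₁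
  Range a x = ∃[ i ] x ≋ a i

  -- The set of all convex combinations of finitely many points of S.
  conv : {d : ℕ} {ℓ : Level} →
         Pred (Point d) ℓ → Pred (Point d) (c ⊔ ℓ₁ ⊔ ℓ₂ ⊔ ℓ)
  conv {d} S x =
    ∃[ m ] Σ[ y ∈ (Fin m → Point d) ] Σ[ w ∈ (Fin m → Carrier) ]
      (∀ i → y i ∈ S) ×
      (∀ i → 0# ≤ w i) ×
      sum +-rawMonoid w ≈ 1# ×
      x ≋ (λ k → sum +-rawMonoid (λ i → w i * y i k))

  -- Since points are compared by _≋_, a predicate is a set of points only
  -- when it respects _≋_; without this, disjointness would not be meaningful.
  record IsPartition {d r : ℕ} {ℓ : Level} (X : Pred (Point d) ℓ)
                     (parts : Fin r → Pred (Point d) ℓ) :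
                     Set (c ⊔ ℓ₁ ⊔ ℓ) where
    field
      respects : ∀ p → parts p Respects _≋_
      disjoint : ∀ p q → p ≢ q → parts p ⊥ parts q
      union    : X ≐ ⋃ (Fin r) parts

  -- Parts are not required to be nonempty separately: conv of an empty
  -- part is empty, so a common point excludes it.
  Divisible : {d : ℕ} {ℓ : Level} →
              ℕ → Pred (Point d) ℓ → Set (c ⊔ ℓ₁ ⊔ ℓ₂ ⊔ lsuc ℓ)
  Divisible {d} {ℓ} r X =
    Σ[ parts ∈ (Fin r → Pred (Point d) ℓ) ]
      IsPartition X parts × Satisfiable (⋂ (Fin r) (λ p → conv (parts p)))

module Submission where

-- Sarkaria's reduction to the colourful Carathéodory theorem.  Write r = s + 1
-- and append a coordinate 1 to each point a i, giving vectors v i of dimension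
-- d + 1.  Choose vectors e₀, …, eₛ of dimension s that add up to 0 and satisfy
-- no other linear relation, up to scalars.  For each i the r tensors eⱼ ⊗ v i,
-- extended by one coordinate that is 1 for j = 0 and 0 otherwise, live in
-- dimension n = s (d + 1) + 1 and add up to the vector b = (0, …, 0, 1), which
-- thus lies in the cone of each of these n "colours" (target-InCone).  By the
-- theorem colourful, b is a nonnegative combination of one tensor from each
-- colour, with indices φ i and coefficients w i.  As e₀ + … + eₛ = 0 is the only
-- relation, the sums of w i · v i over the classes of φ are all equal
-- (part-equal).  The coordinate 1 of the v i and the extra coordinate show that
-- each class has total weight 1, so these sums are convex combinations and
-- their common value lies in the convex hull of every class.
--
-- The colourful theorem is proved by minimising, over the finitely many
-- rainbow choices, the distance from b to the cone of the choice.  Suppose the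
-- minimum is attained at a point z and u = b - z is not 0.  If all coefficients
-- of z are positive, then the n chosen vectors are all orthogonal to u, hence
-- linearly dependent, and the dependence removes one of them from the
-- combination (nearest-on-face).  So some colour is not needed for z.  As
-- ⟨ u , b ⟩ > 0 (residual-acute) and b lies in the cone of this colour, the
-- colour has a vector forming an acute angle with u (cone-acute); moving from z
-- in its direction comes closer to b (exchange), a contradiction.
--
-- Nearest points of finitely generated cones are constructed by induction on
-- the number of generators (nearest), without compactness.  Thus the argument
-- only uses the axioms of an ordered field with decidable order.

open import Defs

open import Algebra.Bundles using (CommutativeRing)
open import Data.Fin.Base using (Fin; zero; suc; punchIn; splitAt; _↑ˡ_; _↑ʳ_; combine; remQuot)
open import Data.Maybe.Base using (Maybe; just; nothing)
open import Data.Nat.Base as ℕ using (ℕ; zero; suc)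
open import Data.Integer.Base as ℤ using (ℤ; +_; -[1+_])
import Data.Integer.Properties as ℤ
import Data.Fin.Properties as Fin
open import Data.Product.Base using (_×_; _,_; proj₁; proj₂; ∃-syntax; Σ-syntax)
open import Data.Sum.Base using (_⊎_; inj₁; inj₂; [_,_]′)
open import Data.Vec.Base as Vec using (Vec; []; _∷_; lookup; _[_]≔_)
import Data.Vec.Properties as Vec
import Data.Vec.Functional as Vector
open import Data.Vec.Functional.Properties using (insertAt-lookup; insertAt-punchIn)
open import Function.Base using (_∘_)
open import Relation.Binary.PropositionalEquality.Core as ≡ using (_≡_; _≢_)
open import Relation.Nullary.Decidable using (Dec; yes; no; ¬?; decidable-stable)
open import Level using (_⊔_)
open import Relation.Nullary.Negation using (¬_; contradiction)

-- Integer coefficients for polynomial identities in a commutative ring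

-- Polynomials over the integers, mapped to R by the canonical homomorphism,
-- have normal forms in which opposite terms cancel, because equality of
-- integer coefficients is decidable.
module IntegerRingSolver {c ℓ} (R : CommutativeRing c ℓ) where
  open CommutativeRing R
  open import Algebra.Properties.Ring ring
    using (-0#≈0#; -‿involutive; -‿distribˡ-*; -‿distribʳ-*; -‿+-comm)
  open import Algebra.Properties.Semiring.Mult.TCOptimised semiring
    using (×-homo-+; ×1-homo-*; 1+×) renaming (_×_ to _×#_)
  open import Algebra.Solver.Ring.AlmostCommutativeRing
    using (fromCommutativeRing; _-Raw-AlmostCommutative⟶_)
  open import Relation.Binary.Reasoning.Setoid setoid
  import Data.Sign.Base as Sign

  fromℤ : ℤ → Carrier
  fromℤ (+ n)      = n ×# 1#
  fromℤ (-[1+ n ]) = - (suc n ×# 1#)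

  fromℤ-⊖ : ∀ m n → fromℤ (m ℤ.⊖ n) ≈ m ×# 1# - n ×# 1#
  fromℤ-⊖ m       zero    = sym (trans (+-congˡ -0#≈0#) (+-identityʳ _))
  fromℤ-⊖ zero    (suc n) = sym (+-identityˡ _)
  fromℤ-⊖ (suc m) (suc n) = begin
    fromℤ (suc m ℤ.⊖ suc n)          ≡⟨ ≡.cong fromℤ (ℤ.[1+m]⊖[1+n]≡m⊖n m n) ⟩
    fromℤ (m ℤ.⊖ n)                  ≈⟨ fromℤ-⊖ m n ⟩
    M - N                            ≈⟨ +-congʳ (+-identityʳ M) ⟨
    M + 0# - N                       ≈⟨ +-congʳ (+-congˡ (-‿inverseʳ 1#)) ⟨
    M + (1# - 1#) - N                ≈⟨ +-congʳ (+-assoc M 1# (- 1#)) ⟨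
    (M + 1#) - 1# - N                ≈⟨ +-assoc (M + 1#) (- 1#) (- N) ⟩
    (M + 1#) + (- 1# - N)            ≈⟨ +-cong (+-comm M 1#) (-‿+-comm 1# N) ⟩
    (1# + M) - (1# + N)              ≈⟨ +-cong (1+× m 1#) (-‿cong (1+× n 1#)) ⟨
    suc m ×# 1# - suc n ×# 1#        ∎
    where M = m ×# 1#
          N = n ×# 1#

  fromℤ-+ : ∀ i j → fromℤ (i ℤ.+ j) ≈ fromℤ i + fromℤ j
  fromℤ-+ (+ m)      (+ n)      = ×-homo-+ 1# m n
  fromℤ-+ (+ m)      (-[1+ n ]) = fromℤ-⊖ m (suc n)
  fromℤ-+ (-[1+ m ]) (+ n)      = trans (fromℤ-⊖ n (suc m)) (+-comm _ _)
  fromℤ-+ (-[1+ m ]) (-[1+ n ]) = begin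
    - (suc (suc (m ℕ.+ n)) ×# 1#)         ≡⟨ ≡.cong (λ k → - (suc k ×# 1#)) (ℕ.+-suc m n) ⟨
    - ((suc m ℕ.+ suc n) ×# 1#)           ≈⟨ -‿cong (×-homo-+ 1# (suc m) (suc n)) ⟩
    - (suc m ×# 1# + suc n ×# 1#)         ≈⟨ -‿+-comm _ _ ⟨
    - (suc m ×# 1#) + - (suc n ×# 1#)     ∎
    where import Data.Nat.Properties as ℕ

  fromℤ-neg : ∀ i → fromℤ (ℤ.- i) ≈ - fromℤ i
  fromℤ-neg (+ zero)   = sym -0#≈0#
  fromℤ-neg (+ suc n)  = refl
  fromℤ-neg (-[1+ n ]) = sym (-‿involutive _)

  fromℤ-neg◃ : ∀ n → fromℤ (Sign.- ℤ.◃ n) ≈ - (n ×# 1#)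
  fromℤ-neg◃ zero    = sym -0#≈0#
  fromℤ-neg◃ (suc n) = refl

  fromℤ-pos◃ : ∀ n → fromℤ (Sign.+ ℤ.◃ n) ≈ n ×# 1#
  fromℤ-pos◃ zero    = refl
  fromℤ-pos◃ (suc n) = refl

  fromℤ-* : ∀ i j → fromℤ (i ℤ.* j) ≈ fromℤ i * fromℤ j
  fromℤ-* (+ m)      (+ n)      = trans (fromℤ-pos◃ (m ℕ.* n)) (×1-homo-* m n)
  fromℤ-* (+ m)      (-[1+ n ]) = begin
    fromℤ (Sign.- ℤ.◃ (m ℕ.* suc n))      ≈⟨ fromℤ-neg◃ (m ℕ.* suc n) ⟩
    - ((m ℕ.* suc n) ×# 1#)               ≈⟨ -‿cong (×1-homo-* m (suc n)) ⟩
    - ((m ×# 1#) * (suc n ×# 1#))         ≈⟨ -‿distribʳ-* _ _ ⟩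
    (m ×# 1#) * - (suc n ×# 1#)           ∎
  fromℤ-* (-[1+ m ]) (+ n)      = begin
    fromℤ (Sign.- ℤ.◃ (suc m ℕ.* n))      ≈⟨ fromℤ-neg◃ (suc m ℕ.* n) ⟩
    - ((suc m ℕ.* n) ×# 1#)               ≈⟨ -‿cong (×1-homo-* (suc m) n) ⟩
    - ((suc m ×# 1#) * (n ×# 1#))         ≈⟨ -‿distribˡ-* _ _ ⟩
    - (suc m ×# 1#) * (n ×# 1#)           ∎
  fromℤ-* (-[1+ m ]) (-[1+ n ]) = begin
    fromℤ (Sign.+ ℤ.◃ (suc m ℕ.* suc n))  ≈⟨ fromℤ-pos◃ (suc m ℕ.* suc n) ⟩
    (suc m ℕ.* suc n) ×# 1#               ≈⟨ ×1-homo-* (suc m) (suc n) ⟩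
    (suc m ×# 1#) * (suc n ×# 1#)         ≈⟨ -‿involutive _ ⟨
    - - ((suc m ×# 1#) * (suc n ×# 1#))   ≈⟨ -‿cong (-‿distribˡ-* _ _) ⟩
    - (- (suc m ×# 1#) * (suc n ×# 1#))   ≈⟨ -‿distribʳ-* _ _ ⟩
    - (suc m ×# 1#) * - (suc n ×# 1#)     ∎

  fromℤ-morphism : ℤ.+-*-rawRing -Raw-AlmostCommutative⟶ fromCommutativeRing R
  fromℤ-morphism = record
    { ⟦_⟧    = fromℤ
    ; +-homo = fromℤ-+
    ; *-homo = fromℤ-*
    ; -‿homo = fromℤ-neg
    ; 0-homo = refl
    ; 1-homo = refl
    }

  coefficient≟ : ∀ i j → Maybe (fromℤ i ≈ fromℤ j)
  coefficient≟ i j with i ℤ.≟ j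
  ... | yes ≡.refl = just refl
  ... | no  _      = nothing

  open import Algebra.Solver.Ring
    ℤ.+-*-rawRing (fromCommutativeRing R) fromℤ-morphism coefficient≟ public
    using (solve; _:=_; _:+_; _:*_; _:-_; :-_; con)

module Tverberg {c ℓ₁ ℓ₂} (ℝ : RealNumbers c ℓ₁ ℓ₂) where

  open RealNumbers ℝ
    using (_≤_; 0≉1; invertible; isDecTotalOrder; +-monoʳ-≤; *-nonNegative; commutativeRing)
  open CommutativeRing commutativeRing hiding (zero)
  open import Relation.Binary.Structures using (IsDecTotalOrder)
  open IsDecTotalOrder isDecTotalOrder
    using (_≟_; _≤?_; total; antisym; ≤-respˡ-≈; ≤-respʳ-≈)
    renaming (refl to ≤-refl; reflexive to ≤-reflexive; trans to ≤-trans)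
  open IntegerRingSolver commutativeRing
  open import Algebra.Properties.Ring ring using (-0#≈0#; -‿involutive)
  open import Algebra.Properties.Semiring.Sum semiring
  open import Relation.Binary.Reasoning.Setoid setoid

  -- Ordered fields

  infix 4 _<_

  -- The strict order: as the order is total, it is the negation of the
  -- reverse inequality.
  _<_ : Carrier → Carrier → Set ℓ₂
  x < y = ¬ (y ≤ x)

  <⇒≤ : ∀ {x y} → x < y → x ≤ y
  <⇒≤ {x} {y} x<y with total x y
  ... | inj₁ x≤y = x≤y
  ... | inj₂ y≤x = contradiction y≤x x<y

  <⇒≉ : ∀ {x y} → x < y → y ≉ x
  <⇒≉ x<y y≈x = x<y (≤-reflexive y≈x)

  ≤∧≉⇒< : ∀ {x y} → x ≤ y → y ≉ x → x < y
  ≤∧≉⇒< x≤y y≉x y≤x = y≉x (antisym y≤x x≤y)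

  ≤⇒0≤- : ∀ {x y} → x ≤ y → 0# ≤ y - x
  ≤⇒0≤- {x} {y} x≤y =
    ≤-respˡ-≈ (-‿inverseˡ x) (≤-respʳ-≈ (+-comm (- x) y) (+-monoʳ-≤ (- x) x≤y))

  -- Inequalities are proved by exhibiting the difference of the two sides
  -- as an expression that is visibly nonnegative.
  certify : ∀ {x y e} → 0# ≤ e → y - x ≈ e → x ≤ y
  certify {x} {y} {e} 0≤e y-x≈e =
    ≤-respˡ-≈ (+-identityʳ x) (≤-respʳ-≈ eq (+-monoʳ-≤ x 0≤e))
    where
    eq : x + e ≈ y
    eq = trans (+-congˡ (sym y-x≈e))
               (solve 2 (λ x y → x :+ (y :- x) := y) refl x y)

  +-nonNegative : ∀ {x y} → 0# ≤ x → 0# ≤ y → 0# ≤ x + y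
  +-nonNegative {x} 0≤x 0≤y =
    ≤-trans 0≤x (≤-respˡ-≈ (+-identityʳ x) (+-monoʳ-≤ x 0≤y))

  ≤0⇒0≤- : ∀ {x} → x ≤ 0# → 0# ≤ - x
  ≤0⇒0≤- x≤0 = ≤-respʳ-≈ (+-identityˡ _) (≤⇒0≤- x≤0)

  0≤-⇒≤0 : ∀ {x} → 0# ≤ - x → x ≤ 0#
  0≤-⇒≤0 0≤-x = certify 0≤-x (+-identityˡ _)

  square-nonNegative : ∀ x → 0# ≤ x * x
  square-nonNegative x with total 0# x
  ... | inj₁ 0≤x = *-nonNegative 0≤x 0≤x
  ... | inj₂ x≤0 = ≤-respʳ-≈ (solve 1 (λ x → (:- x) :* (:- x) := x :* x) refl x)
                     (*-nonNegative (≤0⇒0≤- x≤0) (≤0⇒0≤- x≤0))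

  0≤1 : 0# ≤ 1#
  0≤1 = ≤-respʳ-≈ (*-identityˡ 1#) (square-nonNegative 1#)

  0<1 : 0# < 1#
  0<1 = ≤∧≉⇒< 0≤1 (0≉1 ∘ sym)

  inverse : ∀ x → x ≉ 0# → ∃[ s ] s * x ≈ 1#
  inverse x x≉0 = let s , sx≈1 , _ = invertible x x≉0 in s , sx≈1

  inverse-nonNegative : ∀ {x s} → 0# ≤ x → s * x ≈ 1# → 0# ≤ s
  inverse-nonNegative {x} {s} 0≤x sx≈1 =
    ≤-respʳ-≈ (trans (*-assoc s s x) (trans (*-congˡ sx≈1) (*-identityʳ s)))
      (*-nonNegative (square-nonNegative s) 0≤x)

  *-cancel-0 : ∀ {x y} → x ≉ 0# → x * y ≈ 0# → y ≈ 0#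
  *-cancel-0 {x} {y} x≉0 xy≈0 = let s , sx≈1 = inverse x x≉0 in begin
    y            ≈⟨ *-identityˡ y ⟨
    1# * y       ≈⟨ *-congʳ sx≈1 ⟨
    s * x * y    ≈⟨ *-assoc s x y ⟩
    s * (x * y)  ≈⟨ *-congˡ xy≈0 ⟩
    s * 0#       ≈⟨ zeroʳ s ⟩
    0#           ∎

  *-positive : ∀ {x y} → 0# < x → 0# < y → 0# < x * y
  *-positive 0<x 0<y = ≤∧≉⇒< (*-nonNegative (<⇒≤ 0<x) (<⇒≤ 0<y))
    (<⇒≉ 0<y ∘ *-cancel-0 (<⇒≉ 0<x))

  square-0 : ∀ {x} → x * x ≈ 0# → x ≈ 0#
  square-0 {x} xx≈0 with x ≟ 0#
  ... | yes x≈0 = x≈0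
  ... | no  x≉0 = *-cancel-0 x≉0 xx≈0

  -- For t between 0 and 1 the value x + t (y - x) is a convex combination of
  -- x and y.
  convex-nonNegative : ∀ {x y t} → 0# ≤ x → 0# ≤ y → 0# ≤ t → t ≤ 1# →
                       0# ≤ x + t * (y + - 1# * x)
  convex-nonNegative {x} {y} {t} 0≤x 0≤y 0≤t t≤1 = ≤-respʳ-≈
    (solve 3 (λ x y t → (con (+ 1) :- t) :* x :+ t :* y
                     := x :+ t :* (y :+ (:- con (+ 1)) :* x)) refl x y t)
    (+-nonNegative (*-nonNegative (≤⇒0≤- t≤1) 0≤x) (*-nonNegative 0≤t 0≤y))

  NonNegative : ∀ {m} → (Fin m → Carrier) → Set ℓ₂
  NonNegative w = ∀ i → 0# ≤ w i

  sum-nonNegative : ∀ {m} {f : Fin m → Carrier} → NonNegative f → 0# ≤ sum f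
  sum-nonNegative {zero}  0≤f = ≤-refl
  sum-nonNegative {suc m} 0≤f = +-nonNegative (0≤f zero) (sum-nonNegative (0≤f ∘ suc))

  sum-0⇒0 : ∀ {m} {f : Fin m → Carrier} → NonNegative f → sum f ≈ 0# → ∀ i → f i ≈ 0#
  sum-0⇒0 {suc m} {f} 0≤f ∑f≈0 zero = antisym
    (≤-respʳ-≈ ∑f≈0 (certify (sum-nonNegative (0≤f ∘ suc))
      (solve 2 (λ x y → x :+ y :- x := y) refl (f zero) _)))
    (0≤f zero)
  sum-0⇒0 {suc m} {f} 0≤f ∑f≈0 (suc i) = sum-0⇒0 (0≤f ∘ suc)
    (trans (sym (+-identityˡ _))
      (trans (+-congʳ (sym (sum-0⇒0 0≤f ∑f≈0 zero))) ∑f≈0)) i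

  -- Linear combinations and the standard inner product

  sum-cong : ∀ {m} {f g : Fin m → Carrier} → (∀ i → f i ≈ g i) → sum f ≈ sum g
  sum-cong = sum-cong-≋

  sum-0 : ∀ {m} {f : Fin m → Carrier} → (∀ i → f i ≈ 0#) → sum f ≈ 0#
  sum-0 {m} f≈0 = trans (sum-cong f≈0) (sum-replicate-zero m)

  sum-axpy : ∀ {m} (f g : Fin m → Carrier) t →
             sum (λ i → f i + t * g i) ≈ sum f + t * sum g
  sum-axpy f g t = trans (∑-distrib-+ f (λ i → t * g i))
                         (+-congˡ (sym (*-distribˡ-sum t g)))

  infix 20 ⟨_,_⟩

  -- The standard inner product; ⟨ u , u ⟩ serves as the squared norm.
  ⟨_,_⟩ : ∀ {N} → (Fin N → Carrier) → (Fin N → Carrier) → Carrier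
  ⟨ u , v ⟩ = sum (λ k → u k * v k)

  -- The linear combination of the vectors x with coefficients w.
  lin : ∀ {m N} → (Fin m → Carrier) → (Fin m → Fin N → Carrier) → Fin N → Carrier
  lin w x k = sum (λ i → w i * x i k)

  -- The vector from the linear combination of x with coefficients w to b.
  residual : ∀ {m N} → (Fin N → Carrier) → (Fin m → Fin N → Carrier) →
             (Fin m → Carrier) → Fin N → Carrier
  residual b x w k = b k - lin w x k

  infixl 6 _-[_]_

  -- The vector u - t c.
  _-[_]_ : ∀ {N} → (Fin N → Carrier) → Carrier → (Fin N → Carrier) → Fin N → Carrier
  (u -[ t ] c) k = u k - t * c k

  ⟨⟩-cong : ∀ {N} {u u′ v v′ : Fin N → Carrier} →
            (∀ k → u k ≈ u′ k) → (∀ k → v k ≈ v′ k) → ⟨ u , v ⟩ ≈ ⟨ u′ , v′ ⟩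
  ⟨⟩-cong u≈u′ v≈v′ = sum-cong (λ k → *-cong (u≈u′ k) (v≈v′ k))

  norm-cong : ∀ {N} {u v : Fin N → Carrier} →
              (∀ k → u k ≈ v k) → ⟨ u , u ⟩ ≈ ⟨ v , v ⟩
  norm-cong u≈v = ⟨⟩-cong u≈v u≈v

  ⟨⟩-comm : ∀ {N} (u v : Fin N → Carrier) → ⟨ u , v ⟩ ≈ ⟨ v , u ⟩
  ⟨⟩-comm u v = sum-cong (λ k → *-comm (u k) (v k))

  ⟨⟩-axpyˡ : ∀ {N} (u c v : Fin N → Carrier) t →
             ⟨ u -[ t ] c , v ⟩ ≈ ⟨ u , v ⟩ - t * ⟨ c , v ⟩
  ⟨⟩-axpyˡ u c v t = begin
    sum (λ k → (u k - t * c k) * v k)            ≈⟨ sum-cong (λ k →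
      solve 4 (λ u t c v → (u :- t :* c) :* v := u :* v :+ (:- t) :* (c :* v))
        refl (u k) t (c k) (v k)) ⟩
    sum (λ k → u k * v k + (- t) * (c k * v k))  ≈⟨ sum-axpy (λ k → u k * v k) (λ k → c k * v k) (- t) ⟩
    ⟨ u , v ⟩ + (- t) * ⟨ c , v ⟩                ≈⟨
      solve 3 (λ p t q → p :+ (:- t) :* q := p :- t :* q) refl ⟨ u , v ⟩ t ⟨ c , v ⟩ ⟩
    ⟨ u , v ⟩ - t * ⟨ c , v ⟩                    ∎

  ⟨⟩-axpyʳ : ∀ {N} (v u c : Fin N → Carrier) t →
             ⟨ v , u -[ t ] c ⟩ ≈ ⟨ v , u ⟩ - t * ⟨ v , c ⟩
  ⟨⟩-axpyʳ v u c t = begin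
    ⟨ v , u -[ t ] c ⟩         ≈⟨ ⟨⟩-comm v _ ⟩
    ⟨ u -[ t ] c , v ⟩         ≈⟨ ⟨⟩-axpyˡ u c v t ⟩
    ⟨ u , v ⟩ - t * ⟨ c , v ⟩  ≈⟨ +-cong (⟨⟩-comm u v) (-‿cong (*-congˡ (⟨⟩-comm c v))) ⟩
    ⟨ v , u ⟩ - t * ⟨ v , c ⟩  ∎

  norm-axpy : ∀ {N} (u c : Fin N → Carrier) t →
              ⟨ u -[ t ] c , u -[ t ] c ⟩ ≈
              ⟨ u , u ⟩ - t * (⟨ u , c ⟩ + ⟨ u , c ⟩ - t * ⟨ c , c ⟩)
  norm-axpy u c t = begin
    ⟨ v , v ⟩                                    ≈⟨ ⟨⟩-axpyˡ u c v t ⟩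
    ⟨ u , v ⟩ - t * ⟨ c , v ⟩                    ≈⟨ +-cong (⟨⟩-axpyʳ u u c t)
      (-‿cong (*-congˡ (trans (⟨⟩-axpyʳ c u c t) (+-congʳ (⟨⟩-comm c u))))) ⟩
    (U - t * g) - t * (g - t * C)                ≈⟨
      solve 4 (λ U t g C → (U :- t :* g) :- t :* (g :- t :* C)
                        := U :- t :* (g :+ g :- t :* C)) refl U t g C ⟩
    U - t * (g + g - t * C)                      ∎
    where v = u -[ t ] c
          U = ⟨ u , u ⟩
          g = ⟨ u , c ⟩
          C = ⟨ c , c ⟩

  norm-nonNegative : ∀ {N} (u : Fin N → Carrier) → 0# ≤ ⟨ u , u ⟩
  norm-nonNegative u = sum-nonNegative (λ k → square-nonNegative (u k))

  norm-0⇒0 : ∀ {N} (u : Fin N → Carrier) → ⟨ u , u ⟩ ≈ 0# → ∀ k → u k ≈ 0#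
  norm-0⇒0 u ⟨u,u⟩≈0 k =
    square-0 (sum-0⇒0 (λ k → square-nonNegative (u k)) ⟨u,u⟩≈0 k)

  ⟨⟩-lin : ∀ {m N} (w : Fin m → Carrier) (x : Fin m → Fin N → Carrier) (v : Fin N → Carrier) →
           ⟨ lin w x , v ⟩ ≈ sum (λ i → w i * ⟨ x i , v ⟩)
  ⟨⟩-lin w x v = begin
    sum (λ k → lin w x k * v k)                   ≈⟨ sum-cong (λ k →
      *-distribʳ-sum (v k) (λ i → w i * x i k)) ⟩
    sum (λ k → sum (λ i → w i * x i k * v k))     ≈⟨ ∑-comm (λ k i → w i * x i k * v k) ⟩
    sum (λ i → sum (λ k → w i * x i k * v k))     ≈⟨ sum-cong (λ i →
      trans (sum-cong (λ k → *-assoc (w i) (x i k) (v k)))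
            (sym (*-distribˡ-sum (w i) (λ k → x i k * v k)))) ⟩
    sum (λ i → w i * ⟨ x i , v ⟩)                 ∎

  lin-axpy : ∀ {m N} (w μ : Fin m → Carrier) t (x : Fin m → Fin N → Carrier) k →
             lin (λ i → w i + t * μ i) x k ≈ lin w x k + t * lin μ x k
  lin-axpy w μ t x k = trans
    (sum-cong (λ i → solve 4 (λ w t μ x → (w :+ t :* μ) :* x := w :* x :+ t :* (μ :* x))
                       refl (w i) t (μ i) (x i k)))
    (sum-axpy (λ i → w i * x i k) (λ i → μ i * x i k) t)

  ⟨⟩-residual : ∀ {m N} (b : Fin N → Carrier) (x : Fin m → Fin N → Carrier) w v →
                ⟨ residual b x w , v ⟩ ≈ ⟨ b , v ⟩ - sum (λ i → w i * ⟨ x i , v ⟩)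
  ⟨⟩-residual b x w v = begin
    ⟨ residual b x w , v ⟩            ≈⟨ sum-cong (λ k → *-congʳ (+-congˡ (-‿cong (*-identityˡ (lin w x k))))) ⟨
    ⟨ b -[ 1# ] lin w x , v ⟩         ≈⟨ ⟨⟩-axpyˡ b (lin w x) v 1# ⟩
    ⟨ b , v ⟩ - 1# * ⟨ lin w x , v ⟩  ≈⟨ +-congˡ (-‿cong (trans (*-identityˡ _) (⟨⟩-lin w x v))) ⟩
    ⟨ b , v ⟩ - sum (λ i → w i * ⟨ x i , v ⟩) ∎

  -- The effect of subtracting multiples of one vector d from all vectors x.
  lin-shear : ∀ {m N} (w : Fin m → Carrier) (x : Fin m → Fin N → Carrier)
              (c : Fin m → Carrier) (d : Fin N → Carrier) k →
              lin w (λ i → x i -[ c i ] d) k ≈ lin w x k - sum (λ i → w i * c i) * d k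
  lin-shear w x c d k = begin
    sum (λ i → w i * (x i k - c i * d k))                ≈⟨ sum-cong (λ i →
      solve 4 (λ w x c d → w :* (x :- c :* d) := w :* x :+ (:- d) :* (w :* c))
        refl (w i) (x i k) (c i) (d k)) ⟩
    sum (λ i → w i * x i k + (- d k) * (w i * c i))      ≈⟨
      sum-axpy (λ i → w i * x i k) (λ i → w i * c i) (- d k) ⟩
    lin w x k + (- d k) * sum (λ i → w i * c i)          ≈⟨
      solve 3 (λ l d s → l :+ (:- d) :* s := l :- s :* d) refl (lin w x k) (d k) _ ⟩
    lin w x k - sum (λ i → w i * c i) * d k              ∎

  -- The nearest point of a finitely generated cone

  -- The nonnegative coefficients w give a point of the cone generated by x
  -- whose distance from b is minimal.
  IsNearest : ∀ {m N} → (Fin N → Carrier) → (Fin m → Fin N → Carrier) →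
              (Fin m → Carrier) → Set (c ⊔ ℓ₂)
  IsNearest b x w = NonNegative w × (∀ v → NonNegative v →
    ⟨ residual b x w , residual b x w ⟩ ≤ ⟨ residual b x v , residual b x v ⟩)

  -- The squared norm is convex: on the segment from g to h it stays below its
  -- value at g if it does so at h.
  norm-convex : ∀ {N} (g h : Fin N → Carrier) t → 0# ≤ t → t ≤ 1# →
                ⟨ h , h ⟩ ≤ ⟨ g , g ⟩ →
                let v = g -[ t ] (g -[ 1# ] h) in ⟨ v , v ⟩ ≤ ⟨ g , g ⟩
  norm-convex g h t 0≤t t≤1 H≤G = certify
    (+-nonNegative (*-nonNegative 0≤t (≤⇒0≤- H≤G))
                   (*-nonNegative (*-nonNegative 0≤t (≤⇒0≤- t≤1)) (norm-nonNegative e)))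
    (begin
      G - ⟨ g -[ t ] e , g -[ t ] e ⟩         ≈⟨ +-congˡ (-‿cong (norm-axpy g e t)) ⟩
      G - (G - t * (p + p - t * E))           ≈⟨
        solve 4 (λ G t p E → G :- (G :- t :* (p :+ p :- t :* E))
          := t :* (G :- (G :- con (+ 1) :* (p :+ p :- con (+ 1) :* E)))
             :+ t :* (con (+ 1) :- t) :* E) refl G t p E ⟩
      t * (G - (G - 1# * (p + p - 1# * E))) + t * (1# - t) * E
                                              ≈⟨ +-congʳ (*-congˡ (+-congˡ (-‿cong
        (trans (sym (norm-axpy g e 1#)) (norm-cong g-e≈h))))) ⟩
      t * (G - ⟨ h , h ⟩) + t * (1# - t) * E  ∎)
    where
    e = g -[ 1# ] h
    G = ⟨ g , g ⟩
    E = ⟨ e , e ⟩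
    p = ⟨ g , e ⟩
    g-e≈h : ∀ k → (g -[ 1# ] e) k ≈ h k
    g-e≈h k = solve 2 (λ g h → g :- con (+ 1) :* (g :- con (+ 1) :* h) := h) refl (g k) (h k)

  -- Among all translates of r by multiples of a nonzero vector d, the one
  -- orthogonal to d is the shortest.  Here s is the inverse of ⟨ d , d ⟩.
  norm-projection : ∀ {N} (r d : Fin N → Carrier) s → s * ⟨ d , d ⟩ ≈ 1# → ∀ q →
    let v = r -[ ⟨ r , d ⟩ * s ] d in ⟨ v , v ⟩ ≤ ⟨ r -[ q ] d , r -[ q ] d ⟩
  norm-projection r d s sD≈1 q = certify
    (*-nonNegative (square-nonNegative (q - p * s)) (norm-nonNegative d))
    (begin
      ⟨ r -[ q ] d , r -[ q ] d ⟩ - ⟨ r -[ p * s ] d , r -[ p * s ] d ⟩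
        ≈⟨ +-cong (norm-axpy r d q) (-‿cong (norm-axpy r d (p * s))) ⟩
      (R - q * (p + p - q * D)) - (R - p * s * (p + p - p * s * D))
        ≈⟨ solve 5 (λ R q p D s →
             (R :- q :* (p :+ p :- q :* D)) :- (R :- p :* s :* (p :+ p :- p :* s :* D))
             := (q :- p :* s) :* (q :- p :* s) :* D
                :+ ((p :* s :- q) :* (p :+ p)) :* (con (+ 1) :- s :* D)) refl R q p D s ⟩
      (q - p * s) * (q - p * s) * D + ((p * s - q) * (p + p)) * (1# - s * D)
        ≈⟨ +-congˡ (trans (*-congˡ (trans (+-congˡ (-‿cong sD≈1)) (-‿inverseʳ 1#))) (zeroʳ _)) ⟩
      (q - p * s) * (q - p * s) * D + 0#
        ≈⟨ +-identityʳ _ ⟩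
      (q - p * s) * (q - p * s) * D ∎)
    where R = ⟨ r , r ⟩
          p = ⟨ r , d ⟩
          D = ⟨ d , d ⟩

  -- Projecting a residual along d gives the residual of the projections.
  residual-projection : ∀ {m N} (b : Fin N → Carrier) (x : Fin m → Fin N → Carrier)
    (d : Fin N → Carrier) s w k →
    (residual b x w -[ ⟨ residual b x w , d ⟩ * s ] d) k ≈
    residual (b -[ ⟨ b , d ⟩ * s ] d) (λ i → x i -[ ⟨ x i , d ⟩ * s ] d) w k
  residual-projection b x d s w k = begin
    (b k - L) - ⟨ residual b x w , d ⟩ * s * d k          ≈⟨ +-congˡ (-‿cong (*-congʳ (*-congʳ (⟨⟩-residual b x w d)))) ⟩
    (b k - L) - (⟨ b , d ⟩ - S) * s * d k                 ≈⟨
      solve 6 (λ b L p S s d → (b :- L) :- (p :- S) :* s :* d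
                            := (b :- p :* s :* d) :- (L :- (S :* s) :* d))
        refl (b k) L ⟨ b , d ⟩ S s (d k) ⟩
    (b k - ⟨ b , d ⟩ * s * d k) - (L - (S * s) * d k)     ≈⟨
      +-congˡ (-‿cong (+-congˡ (-‿cong (*-congʳ scale)))) ⟩
    (b k - ⟨ b , d ⟩ * s * d k) - (L - sum (λ i → w i * (⟨ x i , d ⟩ * s)) * d k)
                                                          ≈⟨
      +-congˡ (-‿cong (lin-shear w x (λ i → ⟨ x i , d ⟩ * s) d k)) ⟨
    residual (b -[ ⟨ b , d ⟩ * s ] d) (λ i → x i -[ ⟨ x i , d ⟩ * s ] d) w k ∎
    where
    L = lin w x k
    S = sum (λ i → w i * ⟨ x i , d ⟩)
    scale : S * s ≈ sum (λ i → w i * (⟨ x i , d ⟩ * s))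
    scale = trans (*-distribʳ-sum s (λ i → w i * ⟨ x i , d ⟩))
                  (sum-cong (λ i → *-assoc (w i) ⟨ x i , d ⟩ s))

  residual-drop-0 : ∀ {m N} (b : Fin N → Carrier) (x : Fin (suc m) → Fin N → Carrier) w k →
    w zero * x zero k ≈ 0# → residual b x w k ≈ residual b (x ∘ suc) (w ∘ suc) k
  residual-drop-0 b x w k w₀x₀≈0 = +-congˡ (-‿cong (trans (+-congʳ w₀x₀≈0) (+-identityˡ _)))

  residual-cons : ∀ {m N} (b : Fin N → Carrier) (x : Fin (suc m) → Fin N → Carrier) w k →
    residual b x w k ≈ (residual b (x ∘ suc) (w ∘ suc) -[ w zero ] x zero) k
  residual-cons b x w k =
    solve 3 (λ b p l → b :- (p :+ l) := (b :- l) :- p) refl (b k) (w zero * x zero k) _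

  -- The residual depends affinely on the coefficients.
  residual-convex : ∀ {m N} (b : Fin N → Carrier) (x : Fin m → Fin N → Carrier) v w t k →
    residual b x (λ i → v i + t * (w i + - 1# * v i)) k ≈
    (residual b x v -[ t ] (residual b x v -[ 1# ] residual b x w)) k
  residual-convex b x v w t k = begin
    b k - lin (λ i → v i + t * (w i + - 1# * v i)) x k  ≈⟨ +-congˡ (-‿cong
      (trans (lin-axpy v (λ i → w i + - 1# * v i) t x k)
             (+-congˡ (*-congˡ (lin-axpy w v (- 1#) x k))))) ⟩
    b k - (V + t * (W + - 1# * V))                      ≈⟨
      solve 4 (λ b V W t → b :- (V :+ t :* (W :+ (:- con (+ 1)) :* V))
        := (b :- V) :- t :* ((b :- V) :- con (+ 1) :* (b :- W))) refl (b k) V W t ⟩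
    (b k - V) - t * ((b k - V) - 1# * (b k - W))        ∎
    where V = lin v x k
          W = lin w x k

  ∷-nonNegative : ∀ {m} {w : Fin (suc m) → Carrier} →
                  0# ≤ w zero → NonNegative (w ∘ suc) → NonNegative w
  ∷-nonNegative 0≤w₀ 0≤w zero    = 0≤w₀
  ∷-nonNegative 0≤w₀ 0≤w (suc i) = 0≤w i

  -- Every finitely generated cone has a point nearest to b.  The proof is by
  -- induction on the number of generators.  For a nonzero generator x₀, first
  -- drop the sign constraint on its coefficient: this is the same problem for
  -- the projections along x₀ and one generator less.  If the coefficient p of
  -- x₀ in the solution is nonnegative, nothing is left to do.  Otherwise the
  -- segment from any admissible v to that solution crosses the hyperplane on
  -- which the coefficient of x₀ vanishes, and by convexity the crossing point
  -- is no worse than v, so that x₀ can be discarded.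
  nearest : ∀ {m N} (b : Fin N → Carrier) (x : Fin m → Fin N → Carrier) → ∃[ w ] IsNearest b x w
  nearest {zero}  b x = (λ ()) , (λ ()) , λ _ _ → ≤-refl
  nearest {suc m} b x with ⟨ x zero , x zero ⟩ ≟ 0#
  ... | yes ⟨x₀,x₀⟩≈0 =
    let w , 0≤w , best = nearest b (x ∘ suc)
        drop v = norm-cong λ k → residual-drop-0 b x v k
          (trans (*-congˡ (norm-0⇒0 (x zero) ⟨x₀,x₀⟩≈0 k)) (zeroʳ _))
    in  (0# Vector.∷ w) , ∷-nonNegative ≤-refl 0≤w , λ v 0≤v →
          ≤-respˡ-≈ (sym (drop (0# Vector.∷ w))) (≤-respʳ-≈ (sym (drop v))
            (best (v ∘ suc) (0≤v ∘ suc)))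
  ... | no ⟨x₀,x₀⟩≉0 = decide (0# ≤? p)
    where
    d = x zero
    x′ = x ∘ suc
    s = proj₁ (inverse _ ⟨x₀,x₀⟩≉0)
    sD≈1 = proj₂ (inverse _ ⟨x₀,x₀⟩≉0)
    b⊥ = b -[ ⟨ b , d ⟩ * s ] d
    x⊥ : Fin m → Fin _ → Carrier
    x⊥ i = x′ i -[ ⟨ x′ i , d ⟩ * s ] d
    free = nearest b⊥ x⊥
    w = proj₁ free
    0≤w = proj₁ (proj₂ free)
    p = ⟨ residual b x′ w , d ⟩ * s
    pw : Fin (suc m) → Carrier
    pw = p Vector.∷ w

    pw-best : ∀ v → NonNegative (v ∘ suc) →
      ⟨ residual b x pw , residual b x pw ⟩ ≤ ⟨ residual b x v , residual b x v ⟩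
    pw-best v 0≤v =
      ≤-respˡ-≈ (norm-cong λ k → sym (trans (residual-cons b x pw k) (residual-projection b x′ d s w k)))
      (≤-trans (proj₂ (proj₂ free) (v ∘ suc) 0≤v)
      (≤-respˡ-≈ (norm-cong (residual-projection b x′ d s (v ∘ suc)))
      (≤-respʳ-≈ (norm-cong λ k → sym (residual-cons b x v k))
        (norm-projection (residual b x′ (v ∘ suc)) d s sD≈1 (v zero)))))

    decide : Dec (0# ≤ p) → ∃[ w ] IsNearest b x w
    decide (yes 0≤p) = pw , ∷-nonNegative 0≤p 0≤w , λ v 0≤v → pw-best v (0≤v ∘ suc)
    decide (no p<0) =
      let u , 0≤u , best = nearest b x′ in
      (0# Vector.∷ u) , ∷-nonNegative ≤-refl 0≤u , λ v 0≤v →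
        let 0≤-p = ≤0⇒0≤- (<⇒≤ p<0)
            gap : v zero - p ≉ 0#
            gap v₀-p≈0 = p<0 (≤-trans (0≤v zero)
              (≤-reflexive (trans (solve 2 (λ v p → v := (v :- p) :+ p) refl (v zero) p)
                (trans (+-congʳ v₀-p≈0) (+-identityˡ p)))))
            τ , τ[v₀-p]≈1 = inverse (v zero - p) gap
            0≤τ = inverse-nonNegative (+-nonNegative (0≤v zero) 0≤-p) τ[v₀-p]≈1
            t = v zero * τ
            0≤t = *-nonNegative (0≤v zero) 0≤τ
            -- The defect 1 - t equals - p / (v₀ - p).
            t≤1 : t ≤ 1#
            t≤1 = certify (*-nonNegative 0≤τ 0≤-p) (trans (+-congʳ (sym τ[v₀-p]≈1))
              (solve 3 (λ v p τ → τ :* (v :- p) :- v :* τ := τ :* (:- p)) refl (v zero) p τ))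
            z : Fin (suc m) → Carrier
            z i = v i + t * (pw i + - 1# * v i)
            z₀≈0 : z zero ≈ 0#
            z₀≈0 = trans (solve 3 (λ v p τ → v :+ v :* τ :* (p :+ (:- con (+ 1)) :* v)
                                   := v :* (con (+ 1) :- τ :* (v :- p))) refl (v zero) p τ)
              (trans (*-congˡ (trans (+-congˡ (-‿cong τ[v₀-p]≈1)) (-‿inverseʳ 1#))) (zeroʳ _))
        in  ≤-respˡ-≈ (norm-cong λ k → sym (residual-drop-0 b x (0# Vector.∷ u) k (zeroˡ _)))
            (≤-trans (best (z ∘ suc) (λ i → convex-nonNegative (0≤v (suc i)) (0≤w i) 0≤t t≤1))
            (≤-respˡ-≈ (norm-cong λ k → trans (sym (residual-convex b x v pw t k))
                          (residual-drop-0 b x z k (trans (*-congʳ z₀≈0) (zeroˡ _))))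
              (norm-convex (residual b x v) (residual b x pw) t 0≤t t≤1
                (pw-best v (0≤v ∘ suc)))))

  -- Optimality conditions

  -- The Kronecker delta.
  δ : ∀ {m} → Fin m → Fin m → Carrier
  δ zero    zero    = 1#
  δ zero    (suc j) = 0#
  δ (suc i) zero    = 0#
  δ (suc i) (suc j) = δ i j

  δ-nonNegative : ∀ {m} (i j : Fin m) → 0# ≤ δ i j
  δ-nonNegative zero    zero    = 0≤1
  δ-nonNegative zero    (suc j) = ≤-refl
  δ-nonNegative (suc i) zero    = ≤-refl
  δ-nonNegative (suc i) (suc j) = δ-nonNegative i j

  δ-≡ : ∀ {m} (i : Fin m) → δ i i ≈ 1#
  δ-≡ zero    = refl
  δ-≡ (suc i) = δ-≡ i

  δ-≢ : ∀ {m} {i j : Fin m} → i ≢ j → δ i j ≈ 0#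
  δ-≢ {i = zero}  {zero}  i≢j = contradiction ≡.refl i≢j
  δ-≢ {i = zero}  {suc j} i≢j = refl
  δ-≢ {i = suc i} {zero}  i≢j = refl
  δ-≢ {i = suc i} {suc j} i≢j = δ-≢ (i≢j ∘ ≡.cong suc)

  sum-δ : ∀ {m} (i : Fin m) (f : Fin m → Carrier) → sum (λ k → δ k i * f k) ≈ f i
  sum-δ zero    f = trans (+-cong (*-identityˡ _) (sum-0 (λ k → zeroˡ (f (suc k))))) (+-identityʳ _)
  sum-δ (suc i) f = trans (+-cong (zeroˡ _) (sum-δ i (f ∘ suc))) (+-identityˡ _)

  -- The coefficient w i increased by t.
  shift : ∀ {m} → (Fin m → Carrier) → Fin m → Carrier → Fin m → Carrier
  shift w i t k = w k + t * δ k i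

  shift-nonNegative : ∀ {m} {w : Fin m → Carrier} {i t} → NonNegative w → 0# ≤ w i + t →
                      NonNegative (shift w i t)
  shift-nonNegative {w = w} {i} {t} 0≤w 0≤wᵢ+t k with k Fin.≟ i
  ... | yes ≡.refl = ≤-respʳ-≈ (+-congˡ (sym (trans (*-congˡ (δ-≡ i)) (*-identityʳ t)))) 0≤wᵢ+t
  ... | no  k≢i    = ≤-respʳ-≈
    (sym (trans (+-congˡ (trans (*-congˡ (δ-≢ k≢i)) (zeroʳ t))) (+-identityʳ (w k)))) (0≤w k)

  residual-shift : ∀ {m N} (b : Fin N → Carrier) (x : Fin m → Fin N → Carrier) w i t k →
                   residual b x (shift w i t) k ≈ (residual b x w -[ t ] x i) k
  residual-shift b x w i t k = begin
    b k - lin (shift w i t) x k        ≈⟨ +-congˡ (-‿cong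
      (trans (lin-axpy w (λ k → δ k i) t x k) (+-congˡ (*-congˡ (sum-δ i (λ i → x i k)))))) ⟩
    b k - (lin w x k + t * x i k)      ≈⟨
      solve 4 (λ b l t x → b :- (l :+ t :* x) := (b :- l) :- t :* x) refl (b k) (lin w x k) t (x i k) ⟩
    (b k - lin w x k) - t * x i k      ∎

  -- A vector u is shortened by a step of prescribed maximal length in any
  -- direction forming an acute angle with it.
  descent : ∀ {N} (u c : Fin N → Carrier) {T} → 0# < ⟨ u , c ⟩ → 0# < T →
            ∃[ t ] 0# ≤ t × t ≤ T × ⟨ u -[ t ] c , u -[ t ] c ⟩ < ⟨ u , u ⟩
  descent u c {T} 0<g 0<T =
    let t , 0<t , t≤T , tC≤g = step in
    t , <⇒≤ 0<t , t≤T , λ U≤V → *-positive 0<t 0<g (0≤-⇒≤0 (≤-respʳ-≈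
      (begin
        ⟨ u -[ t ] c , u -[ t ] c ⟩ - U + t * (g - t * C)  ≈⟨ +-congʳ (+-congʳ (norm-axpy u c t)) ⟩
        U - t * (g + g - t * C) - U + t * (g - t * C)      ≈⟨
          solve 4 (λ U t g C → U :- t :* (g :+ g :- t :* C) :- U :+ t :* (g :- t :* C)
                            := :- (t :* g)) refl U t g C ⟩
        - (t * g)                                          ∎)
      (+-nonNegative (≤⇒0≤- U≤V) (*-nonNegative (<⇒≤ 0<t) (≤⇒0≤- tC≤g)))))
    where
    U = ⟨ u , u ⟩
    g = ⟨ u , c ⟩
    C = ⟨ c , c ⟩
    -- The step is the minimum of T and g / C.
    step : ∃[ t ] 0# < t × t ≤ T × t * C ≤ g
    step with T * C ≤? g
    ... | yes TC≤g = T , 0<T , ≤-refl , TC≤g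
    ... | no  g<TC =
      let C≉0 C≈0 = g<TC (≤-trans (≤-reflexive (trans (*-congˡ C≈0) (zeroʳ T))) (<⇒≤ 0<g))
          s , sC≈1 = inverse C C≉0
          0≤s = inverse-nonNegative (norm-nonNegative c) sC≈1
          gsC≈g : g * s * C ≈ g
          gsC≈g = trans (*-assoc g s C) (trans (*-congˡ sC≈1) (*-identityʳ g))
      in  g * s
        , ≤∧≉⇒< (*-nonNegative (<⇒≤ 0<g) 0≤s)
            (λ gs≈0 → <⇒≉ 0<g (trans (sym gsC≈g) (trans (*-congʳ gs≈0) (zeroˡ C))))
        , certify (*-nonNegative (≤⇒0≤- (<⇒≤ g<TC)) 0≤s)
            (trans (+-congʳ (trans (sym (*-identityʳ T)) (*-congˡ (sym sC≈1))))
              (solve 4 (λ T g s C → T :* (s :* C) :- g :* s := (T :* C :- g) :* s) refl T g s C))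
        , ≤-reflexive gsC≈g

  -- At a nearest point the residual forms no acute angle with a generator,
  -- for otherwise adding a small multiple of this generator is an improvement.
  nearest-obtuse : ∀ {m N} (b : Fin N → Carrier) (x : Fin m → Fin N → Carrier) w →
                   IsNearest b x w → ∀ i → ⟨ residual b x w , x i ⟩ ≤ 0#
  nearest-obtuse b x w (0≤w , best) i with ⟨ residual b x w , x i ⟩ ≤? 0#
  ... | yes g≤0 = g≤0
  ... | no  0<g =
    let t , 0≤t , _ , shorter = descent (residual b x w) (x i) 0<g 0<1 in
    contradiction
      (≤-respʳ-≈ (norm-cong (residual-shift b x w i t))
        (best (shift w i t) (shift-nonNegative 0≤w (+-nonNegative (0≤w i) 0≤t))))
      shorter

  -- Complementary slackness: a generator used with positive coefficient is
  -- not on the far side of the hyperplane orthogonal to the residual.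
  nearest-active : ∀ {m N} (b : Fin N → Carrier) (x : Fin m → Fin N → Carrier) w →
                   IsNearest b x w → ∀ i → 0# < w i → 0# ≤ ⟨ residual b x w , x i ⟩
  nearest-active b x w (0≤w , best) i 0<wᵢ with 0# ≤? ⟨ residual b x w , x i ⟩
  ... | yes 0≤g = 0≤g
  ... | no  g<0 =
    let t , 0≤t , t≤wᵢ , shorter = descent u -x (λ ⟨u,-x⟩≤0 →
          g<0 (≤-respʳ-≈ (-‿involutive g) (≤0⇒0≤- (≤-respˡ-≈ (sym -g≈⟨u,-x⟩) ⟨u,-x⟩≤0)))) 0<wᵢ
    in contradiction
      (≤-respʳ-≈ (norm-cong λ k → trans (residual-shift b x w i (- t) k)
          (solve 3 (λ u t x → u :- (:- t) :* x := u :- t :* (:- x)) refl (u k) t (x i k)))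
        (best (shift w i (- t)) (shift-nonNegative 0≤w (≤⇒0≤- t≤wᵢ))))
      shorter
    where
    u = residual b x w
    g = ⟨ u , x i ⟩
    -x : Fin _ → Carrier
    -x k = - x i k
    -g≈⟨u,-x⟩ : - g ≈ ⟨ u , -x ⟩
    -g≈⟨u,-x⟩ = begin
      - g                                 ≈⟨ solve 1 (λ g → :- g := (:- con (+ 1)) :* g) refl g ⟩
      (- 1#) * g                          ≈⟨ *-distribˡ-sum (- 1#) (λ k → u k * x i k) ⟩
      sum (λ k → (- 1#) * (u k * x i k))  ≈⟨ sum-cong (λ k →
        solve 2 (λ u x → (:- con (+ 1)) :* (u :* x) := u :* (:- x)) refl (u k) (x i k)) ⟩
      ⟨ u , -x ⟩                          ∎

  -- Linear dependence

  -- Any m + 1 vectors of dimension m are linearly dependent, by Gaussian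
  -- elimination of the first coordinate.
  dependence : ∀ {m} (x : Fin (suc m) → Fin m → Carrier) →
               ∃[ μ ] (∃[ i ] μ i ≉ 0#) × (∀ k → lin μ x k ≈ 0#)
  dependence {zero} x = (λ _ → 1#) , (zero , 0≉1 ∘ sym) , λ ()
  dependence {suc m} x with Fin.any? (λ i → ¬? (x i zero ≟ 0#))
  ... | no none =
    let μ , (i , μᵢ≉0) , μx≈0 = dependence (λ i k → x (suc i) (suc k))
        x₀≈0 : ∀ i → x i zero ≈ 0#
        x₀≈0 i = decidable-stable (x i zero ≟ 0#) (λ xᵢ₀≉0 → none (i , xᵢ₀≉0))
    in  (0# Vector.∷ μ) , (suc i , μᵢ≉0) , λ where
          zero    → sum-0 (λ i → trans (*-congˡ {(0# Vector.∷ μ) i} (x₀≈0 i)) (zeroʳ _))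
          (suc k) → trans (+-congʳ (zeroˡ _)) (trans (+-identityˡ _) (μx≈0 k))
  ... | yes (p , xₚ₀≉0) = μ , (punchIn p i , μᵢ≉0) , μx≈0
    where
    s = proj₁ (inverse _ xₚ₀≉0)
    sxₚ₀≈1 = proj₂ (inverse _ xₚ₀≉0)
    q : Fin (suc m) → Fin (suc (suc m))
    q = punchIn p
    a : Fin (suc m) → Carrier
    a i = x (q i) zero * s
    x′ : Fin (suc m) → Fin (suc m) → Carrier
    x′ i = x (q i) -[ a i ] x p
    rec = dependence (λ i k → x′ i (suc k))
    ν = proj₁ rec
    i = proj₁ (proj₁ (proj₂ rec))
    S = sum (λ i → ν i * a i)
    μ : Fin (suc (suc m)) → Carrier
    μ = Vector.insertAt ν p (- S)
    μᵢ≉0 : μ (q i) ≉ 0#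
    μᵢ≉0 μᵢ≈0 = proj₂ (proj₁ (proj₂ rec))
      (trans (reflexive (≡.sym (insertAt-punchIn ν p (- S) i))) μᵢ≈0)
    νx′≈0 : ∀ k → lin ν x′ k ≈ 0#
    νx′≈0 zero    = sum-0 (λ i → trans (*-congˡ (begin
      x (q i) zero - x (q i) zero * s * x p zero  ≈⟨
        solve 3 (λ y s z → y :- y :* s :* z := y :* (con (+ 1) :- s :* z)) refl (x (q i) zero) s (x p zero) ⟩
      x (q i) zero * (1# - s * x p zero)          ≈⟨
        *-congˡ (trans (+-congˡ (-‿cong sxₚ₀≈1)) (-‿inverseʳ 1#)) ⟩
      x (q i) zero * 0#                           ≈⟨ zeroʳ _ ⟩
      0#                                          ∎)) (zeroʳ (ν i)))
    νx′≈0 (suc k) = proj₂ (proj₂ rec) k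
    μx≈0 : ∀ k → lin μ x k ≈ 0#
    μx≈0 k = begin
      lin μ x k                                            ≈⟨ sum-remove {i = p} (λ i → μ i * x i k) ⟩
      μ p * x p k + sum (λ i → μ (q i) * x (q i) k)        ≈⟨ +-cong
        (*-congʳ (reflexive (insertAt-lookup ν p (- S))))
        (sum-cong (λ i → *-congʳ {x (q i) k} (reflexive (insertAt-punchIn ν p (- S) i)))) ⟩
      - S * x p k + sum (λ i → ν i * x (q i) k)            ≈⟨
        solve 3 (λ S d l → (:- S) :* d :+ l := l :- S :* d) refl S (x p k) _ ⟩
      lin ν (x ∘ q) k - S * x p k                          ≈⟨ lin-shear ν (x ∘ q) a (x p) k ⟨
      lin ν x′ k                                           ≈⟨ νx′≈0 k ⟩
      0#                                                   ∎

  -- Minima over finite sets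

  -- Every function on A attains its minimum.
  HasMinima : ∀ {a} → Set a → Set _
  HasMinima A = (f : A → Carrier) → ∃[ v ] (∀ v′ → f v ≤ f v′)

  Fin-minima : ∀ m → HasMinima (Fin (suc m))
  Fin-minima zero    f = zero , λ where zero → ≤-refl
  Fin-minima (suc m) f with Fin-minima m (f ∘ suc)
  ... | i , best with total (f zero) (f (suc i))
  ...   | inj₁ f₀≤fᵢ = zero , λ where
    zero    → ≤-refl
    (suc j) → ≤-trans f₀≤fᵢ (best j)
  ...   | inj₂ fᵢ≤f₀ = suc i , λ where
    zero    → fᵢ≤f₀
    (suc j) → best j

  Vec-minima : ∀ {a} {A : Set a} → HasMinima A → ∀ n → HasMinima (Vec A n)
  Vec-minima minima zero    f = [] , λ where [] → ≤-refl
  Vec-minima minima (suc n) f =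
    let tails h = Vec-minima minima n (f ∘ (h ∷_))
        h , best = minima (λ h → f (h ∷ proj₁ (tails h)))
    in  h ∷ proj₁ (tails h) , λ where
          (h′ ∷ t′) → ≤-trans (best h′) (proj₂ (tails h′) t′)

  -- The colourful Carathéodory theorem for cones

  residual-cong : ∀ {m N} (b : Fin N → Carrier) {x x′ : Fin m → Fin N → Carrier} {w w′} →
                  (∀ i k → w i * x i k ≈ w′ i * x′ i k) →
                  ∀ k → residual b x w k ≈ residual b x′ w′ k
  residual-cong b wx≈w′x′ k = +-congˡ (-‿cong (sum-cong (λ i → wx≈w′x′ i k)))

  -- Carathéodory's reduction: move along a linear dependence until a
  -- coefficient vanishes.  The first to vanish is one with the least
  -- ratio μ i / w i.
  reduce : ∀ {m N} (x : Fin m → Fin N → Carrier) w μ → (∀ i → 0# < w i) →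
           (∀ k → lin μ x k ≈ 0#) → (∃[ j ] μ j < 0#) →
           ∃[ v ] NonNegative v × (∃[ i ] v i ≈ 0#) × (∀ k → lin v x k ≈ lin w x k)
  reduce {suc m} x w μ 0<w μx≈0 (j , μⱼ<0) =
    v , 0≤v , (i , vᵢ≈0) , λ k → trans (lin-axpy w μ t x k)
      (trans (+-congˡ (trans (*-congˡ (μx≈0 k)) (zeroʳ t))) (+-identityʳ _))
    where
    w⁻¹ : ∀ k → ∃[ s ] s * w k ≈ 1#
    w⁻¹ k = inverse (w k) (<⇒≉ (0<w k))
    σ : Fin (suc m) → Carrier
    σ k = μ k * proj₁ (w⁻¹ k)
    σw≈μ : ∀ k → σ k * w k ≈ μ k
    σw≈μ k = trans (*-assoc _ _ _) (trans (*-congˡ (proj₂ (w⁻¹ k))) (*-identityʳ _))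
    least = Fin-minima m σ
    i = proj₁ least
    σᵢ<0 : σ i < 0#
    σᵢ<0 0≤σᵢ = μⱼ<0 (≤-respʳ-≈ (σw≈μ j)
      (*-nonNegative (≤-trans 0≤σᵢ (proj₂ least j)) (<⇒≤ (0<w j))))
    0≤-σᵢ : 0# ≤ - σ i
    0≤-σᵢ = ≤0⇒0≤- (<⇒≤ σᵢ<0)
    -σᵢ⁻¹ = inverse (- σ i) (λ -σᵢ≈0 → σᵢ<0 (≤-reflexive
      (trans (sym -0#≈0#) (trans (-‿cong (sym -σᵢ≈0)) (-‿involutive (σ i))))))
    t = proj₁ -σᵢ⁻¹
    v : Fin (suc m) → Carrier
    v k = w k + t * μ k
    v≈ : ∀ k → v k ≈ w k * (t * (σ k - σ i))
    v≈ k = begin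
      w k + t * μ k                              ≈⟨ +-cong
        (trans (sym (*-identityʳ _)) (*-congˡ (sym (proj₂ -σᵢ⁻¹)))) (*-congˡ (sym (σw≈μ k))) ⟩
      w k * (t * - σ i) + t * (σ k * w k)        ≈⟨
        solve 4 (λ w t a b → w :* (t :* (:- a)) :+ t :* (b :* w) := w :* (t :* (b :- a)))
          refl (w k) t (σ i) (σ k) ⟩
      w k * (t * (σ k - σ i))                    ∎
    0≤v : NonNegative v
    0≤v k = ≤-respʳ-≈ (sym (v≈ k)) (*-nonNegative (<⇒≤ (0<w k))
      (*-nonNegative (inverse-nonNegative 0≤-σᵢ (proj₂ -σᵢ⁻¹)) (≤⇒0≤- (proj₂ least k))))
    vᵢ≈0 : v i ≈ 0#
    vᵢ≈0 = trans (v≈ i)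
      (trans (*-congˡ (trans (*-congˡ (-‿inverseʳ (σ i))) (zeroʳ t))) (zeroʳ (w i)))

  -- If b lies outside the cone of m vectors of dimension m, then the nearest
  -- point of this cone is in the cone of fewer of them.  For if all its
  -- coefficients are positive, then all the vectors are orthogonal to the
  -- nonzero residual, hence linearly dependent, and one of them can be
  -- eliminated.
  nearest-on-face : ∀ {m} (b : Fin m → Carrier) (x : Fin m → Fin m → Carrier) w →
    IsNearest b x w → ⟨ residual b x w , residual b x w ⟩ ≉ 0# →
    ∃[ v ] NonNegative v × (∃[ i ] v i ≈ 0#) × (∀ k → lin v x k ≈ lin w x k)
  nearest-on-face {m} b x w opt@(0≤w , _) ⟨u,u⟩≉0 with Fin.any? (λ i → w i ≟ 0#)
  ... | yes (i , wᵢ≈0) = w , 0≤w , (i , wᵢ≈0) , λ _ → refl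
  ... | no none with dependence (residual b x w Vector.∷ x)
  ...   | μ , nontrivial , μux≈0 = conclude nontrivial
    where
    u = residual b x w
    ν : Fin m → Carrier
    ν = μ ∘ suc
    0<w : ∀ i → 0# < w i
    0<w i = ≤∧≉⇒< (0≤w i) (λ wᵢ≈0 → none (i , wᵢ≈0))
    orthogonal : ∀ i → ⟨ x i , u ⟩ ≈ 0#
    orthogonal i = trans (⟨⟩-comm (x i) u)
      (antisym (nearest-obtuse b x w opt i) (nearest-active b x w opt i (0<w i)))
    -- The inner product of the dependence with u isolates the term of u.
    μ₀⟨u,u⟩≈0 : ⟨ u , u ⟩ * μ zero ≈ 0#
    μ₀⟨u,u⟩≈0 = begin
      ⟨ u , u ⟩ * μ zero                                    ≈⟨ *-comm _ _ ⟩
      μ zero * ⟨ u , u ⟩                                    ≈⟨ +-identityʳ _ ⟨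
      μ zero * ⟨ u , u ⟩ + 0#                               ≈⟨ +-congˡ (sum-0 (λ i →
        trans (*-congˡ (orthogonal i)) (zeroʳ (ν i)))) ⟨
      μ zero * ⟨ u , u ⟩ + sum (λ i → ν i * ⟨ x i , u ⟩)    ≈⟨ ⟨⟩-lin μ (u Vector.∷ x) u ⟨
      ⟨ lin μ (u Vector.∷ x) , u ⟩                          ≈⟨ sum-0 (λ k →
        trans (*-congʳ (μux≈0 k)) (zeroˡ (u k))) ⟩
      0#                                                    ∎
    μ₀≈0 : μ zero ≈ 0#
    μ₀≈0 = *-cancel-0 ⟨u,u⟩≉0 μ₀⟨u,u⟩≈0
    νx≈0 : ∀ k → lin ν x k ≈ 0#
    νx≈0 k = trans (sym (+-identityˡ _))
      (trans (+-congʳ (sym (trans (*-congʳ μ₀≈0) (zeroˡ (u k))))) (μux≈0 k))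
    -νx≈0 : ∀ k → lin (λ i → - ν i) x k ≈ 0#
    -νx≈0 k = begin
      sum (λ i → - ν i * x i k)             ≈⟨ sum-cong (λ i →
        solve 2 (λ ν x → (:- ν) :* x := (:- con (+ 1)) :* (ν :* x)) refl (ν i) (x i k)) ⟩
      sum (λ i → (- 1#) * (ν i * x i k))    ≈⟨ *-distribˡ-sum (- 1#) (λ i → ν i * x i k) ⟨
      (- 1#) * lin ν x k                    ≈⟨ trans (*-congˡ (νx≈0 k)) (zeroʳ _) ⟩
      0#                                    ∎
    conclude : (∃[ i ] μ i ≉ 0#) →
      ∃[ v ] NonNegative v × (∃[ i ] v i ≈ 0#) × (∀ k → lin v x k ≈ lin w x k)
    conclude (zero  , μ₀≉0) = contradiction μ₀≈0 μ₀≉0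
    conclude (suc j , νⱼ≉0) with 0# ≤? ν j
    ... | no  νⱼ<0 = reduce x w ν 0<w νx≈0 (j , νⱼ<0)
    ... | yes 0≤νⱼ = reduce x w (λ i → - ν i) 0<w -νx≈0
      (j , λ 0≤-νⱼ → νⱼ≉0 (antisym (0≤-⇒≤0 0≤-νⱼ) 0≤νⱼ))

  sum-nonPositive : ∀ {m} {f : Fin m → Carrier} → (∀ i → f i ≤ 0#) → sum f ≤ 0#
  sum-nonPositive {zero}  f≤0 = ≤-refl
  sum-nonPositive {suc m} f≤0 =
    ≤-trans (+-monoʳ-≤ _ (sum-nonPositive (f≤0 ∘ suc))) (≤-respˡ-≈ (sym (+-identityʳ _)) (f≤0 zero))

  *-nonPositive : ∀ {x y} → 0# ≤ x → y ≤ 0# → x * y ≤ 0#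
  *-nonPositive {x} {y} 0≤x y≤0 = 0≤-⇒≤0
    (≤-respʳ-≈ (solve 2 (λ x y → x :* (:- y) := :- (x :* y)) refl x y)
      (*-nonNegative 0≤x (≤0⇒0≤- y≤0)))

  -- The point b lies in the convex cone generated by the vectors x.
  InCone : ∀ {m N} → (Fin m → Fin N → Carrier) → (Fin N → Carrier) → Set (c ⊔ ℓ₁ ⊔ ℓ₂)
  InCone x b = ∃[ w ] NonNegative w × (∀ k → b k ≈ lin w x k)

  -- An open half-space bounded by a hyperplane through 0 that contains a point
  -- of a cone contains a generator.
  cone-acute : ∀ {m N} {x : Fin m → Fin N → Carrier} {b} u →
               InCone x b → 0# < ⟨ u , b ⟩ → ∃[ j ] 0# < ⟨ u , x j ⟩
  cone-acute {x = x} {b} u (w , 0≤w , b≈wx) 0<ub with Fin.any? (λ j → ¬? (⟨ u , x j ⟩ ≤? 0#))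
  ... | yes found = found
  ... | no  none  = contradiction (≤-respˡ-≈ (sym ⟨u,b⟩≈) (sum-nonPositive (λ j →
      *-nonPositive (0≤w j) (≤-respˡ-≈ (⟨⟩-comm u (x j))
        (decidable-stable (⟨ u , x j ⟩ ≤? 0#) (λ 0<uxⱼ → none (j , 0<uxⱼ))))))) 0<ub
    where
    ⟨u,b⟩≈ : ⟨ u , b ⟩ ≈ sum (λ j → w j * ⟨ x j , u ⟩)
    ⟨u,b⟩≈ = trans (⟨⟩-comm u b) (trans (⟨⟩-cong b≈wx (λ _ → refl)) (⟨⟩-lin w x u))

  -- If the nearest point z is not b, then u = b - z satisfies ⟨ u , b ⟩ > 0:
  -- by complementary slackness ⟨ u , z ⟩ is not negative.
  residual-acute : ∀ {m N} (b : Fin N → Carrier) (x : Fin m → Fin N → Carrier) w →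
    IsNearest b x w → let u = residual b x w in ⟨ u , u ⟩ ≉ 0# → 0# < ⟨ u , b ⟩
  residual-acute b x w opt@(0≤w , _) ⟨u,u⟩≉0 ub≤0 =
    ⟨u,u⟩≉0 (antisym (≤-trans (certify 0≤S eq) ub≤0) (norm-nonNegative u))
    where
    u = residual b x w
    S = sum (λ i → w i * ⟨ x i , u ⟩)
    0≤S : 0# ≤ S
    0≤S = sum-nonNegative λ i → term i (w i ≟ 0#)
      where
      term : ∀ i → Dec (w i ≈ 0#) → 0# ≤ w i * ⟨ x i , u ⟩
      term i (yes wᵢ≈0) = ≤-reflexive (sym (trans (*-congʳ wᵢ≈0) (zeroˡ _)))
      term i (no  wᵢ≉0) = *-nonNegative (0≤w i) (≤-respʳ-≈ (⟨⟩-comm u (x i))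
        (nearest-active b x w opt i (≤∧≉⇒< (0≤w i) wᵢ≉0)))
    eq : ⟨ u , b ⟩ - ⟨ u , u ⟩ ≈ S
    eq = begin
      ⟨ u , b ⟩ - ⟨ u , u ⟩        ≈⟨ +-cong (⟨⟩-comm u b) (-‿cong (⟨⟩-residual b x w u)) ⟩
      ⟨ b , u ⟩ - (⟨ b , u ⟩ - S)  ≈⟨ solve 2 (λ p S → p :- (p :- S) := S) refl ⟨ b , u ⟩ S ⟩
      S                            ∎

  -- The choice φ of one vector of each colour, where the vectors of colour i
  -- are the y i j for varying j.
  rainbow : ∀ {n s N} → (Fin n → Fin s → Fin N → Carrier) → Vec (Fin s) n → Fin n → Fin N → Carrier
  rainbow y φ i = y i (lookup φ i)

  -- Exchanging a vector with vanishing coefficient for one of the same colour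
  -- that forms an acute angle with the residual gives a cone with a point closer
  -- to b.
  exchange : ∀ {n s N} (y : Fin n → Fin s → Fin N → Carrier) (b : Fin N → Carrier) φ v →
    NonNegative v → ∀ i j → v i ≈ 0# →
    let u = residual b (rainbow y φ) v in 0# < ⟨ u , y i j ⟩ →
    ∃[ ψ ] ∃[ v′ ] NonNegative v′ ×
      ⟨ residual b (rainbow y ψ) v′ , residual b (rainbow y ψ) v′ ⟩ < ⟨ u , u ⟩
  exchange y b φ v 0≤v i j vᵢ≈0 0<uyᵢⱼ =
    let t , 0≤t , _ , shorter = descent u (y i j) 0<uyᵢⱼ 0<1 in
    ψ , shift v i t , shift-nonNegative 0≤v (+-nonNegative (0≤v i) 0≤t) ,
    λ le → shorter (≤-respʳ-≈ (norm-cong (residual≈ t)) le)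
    where
    u = residual b (rainbow y φ) v
    ψ = φ [ i ]≔ j
    unchanged : ∀ l k → v l * rainbow y ψ l k ≈ v l * rainbow y φ l k
    unchanged l k with l Fin.≟ i
    ... | yes ≡.refl = trans (trans (*-congʳ vᵢ≈0) (zeroˡ _))
                             (sym (trans (*-congʳ vᵢ≈0) (zeroˡ _)))
    ... | no  l≢i    = *-congˡ (reflexive
      (≡.cong (λ j → y l j k) (Vec.lookup∘update′ l≢i φ j)))
    residual≈ : ∀ t k → residual b (rainbow y ψ) (shift v i t) k ≈ (u -[ t ] y i j) k
    residual≈ t k = begin
      residual b (rainbow y ψ) (shift v i t) k               ≈⟨ residual-shift b (rainbow y ψ) v i t k ⟩
      residual b (rainbow y ψ) v k - t * y i (lookup ψ i) k  ≈⟨ +-cong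
        (residual-cong b unchanged k)
        (-‿cong (*-congˡ (reflexive (≡.cong (λ j → y i j k) (Vec.lookup∘update i φ j))))) ⟩
      u k - t * y i j k                                      ∎

  -- If the cone of a rainbow choice φ does not contain b, then another rainbow
  -- choice has a cone closer to b.
  improve : ∀ {n s} (y : Fin n → Fin s → Fin n → Carrier) (b : Fin n → Carrier) →
    (∀ i → InCone (y i) b) → ∀ φ w → IsNearest b (rainbow y φ) w →
    let u = residual b (rainbow y φ) w in ⟨ u , u ⟩ ≉ 0# →
    ∃[ ψ ] ∃[ v ] NonNegative v ×
      ⟨ residual b (rainbow y ψ) v , residual b (rainbow y ψ) v ⟩ < ⟨ u , u ⟩
  improve y b colours φ w opt ⟨u,u⟩≉0 =
    let v , 0≤v , (i , vᵢ≈0) , vx≈wx = nearest-on-face b x w opt ⟨u,u⟩≉0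
        j , 0<uyᵢⱼ = cone-acute u (colours i) (residual-acute b x w opt ⟨u,u⟩≉0)
        u≈u′ : ∀ k → u k ≈ residual b x v k
        u≈u′ k = +-congˡ (-‿cong (sym (vx≈wx k)))
        ψ , v′ , 0≤v′ , shorter = exchange y b φ v 0≤v i j vᵢ≈0
          (λ le → 0<uyᵢⱼ (≤-respˡ-≈ (sym (⟨⟩-cong u≈u′ (λ _ → refl))) le))
    in  ψ , v′ , 0≤v′ , λ le → shorter (≤-respˡ-≈ (norm-cong u≈u′) le)
    where
    x = rainbow y φ
    u = residual b x w

  -- If b lies in the cone of each of n colours in dimension n, then b lies in
  -- the cone of a rainbow choice: the one whose cone comes closest to b.
  colourful : ∀ {n s} (y : Fin n → Fin (suc s) → Fin n → Carrier) (b : Fin n → Carrier) →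
              (∀ i → InCone (y i) b) → ∃[ φ ] InCone (rainbow y φ) b
  colourful {n} {s} y b colours =
    let φ , best = Vec-minima (Fin-minima s) n distance
    in  φ , conclude φ best (distance φ ≟ 0#)
    where
    u : Vec (Fin (suc s)) n → Fin n → Carrier
    u φ = residual b (rainbow y φ) (proj₁ (nearest b (rainbow y φ)))
    distance : Vec (Fin (suc s)) n → Carrier
    distance φ = ⟨ u φ , u φ ⟩
    conclude : ∀ φ → (∀ ψ → distance φ ≤ distance ψ) → Dec (distance φ ≈ 0#) →
               InCone (rainbow y φ) b
    conclude φ best (yes ⟨u,u⟩≈0) =
      let w , 0≤w , _ = nearest b (rainbow y φ) in w , 0≤w , λ k → begin
        b k                             ≈⟨ solve 2 (λ b l → b := (b :- l) :+ l) refl (b k) _ ⟩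
        u φ k + lin w (rainbow y φ) k   ≈⟨ +-congʳ (norm-0⇒0 (u φ) ⟨u,u⟩≈0 k) ⟩
        0# + lin w (rainbow y φ) k      ≈⟨ +-identityˡ _ ⟩
        lin w (rainbow y φ) k           ∎
    conclude φ best (no ⟨u,u⟩≉0) =
      let w , opt = nearest b (rainbow y φ)
          ψ , v , 0≤v , shorter = improve y b colours φ w opt ⟨u,u⟩≉0
      in  contradiction (≤-trans (best ψ) (proj₂ (proj₂ (nearest b (rainbow y ψ))) v 0≤v)) shorter

  -- Sarkaria's tensors and partitions

  -- Let e₁, …, eₛ be the standard basis and e₀ = - (e₁ + … + eₛ), so that
  -- e₀ + … + eₛ = 0 is, up to scalars, the only linear relation between these
  -- vectors.  The tensor of v with index j is eⱼ ⊗ v followed by one further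
  -- coordinate, which is 1 for j = 0 and 0 otherwise.
  tensorAt : ∀ {s D} → (Fin D → Carrier) → Fin (suc s) → Fin (s ℕ.* D) ⊎ Fin 1 → Carrier
  tensorAt {s} {D} v j (inj₁ q) =
    let p , k = remQuot {s} D q in (δ j (suc p) - δ j zero) * v k
  tensorAt         v j (inj₂ _) = δ j zero

  tensor : ∀ {s D} → (Fin D → Carrier) → Fin (suc s) → Fin (s ℕ.* D ℕ.+ 1) → Carrier
  tensor {s} {D} v j l = tensorAt v j (splitAt (s ℕ.* D) l)

  -- The coordinates of the vector that has 1 in the further coordinate of the
  -- tensors and 0 elsewhere.
  targetAt : ∀ {s D} → Fin (s ℕ.* D) ⊎ Fin 1 → Carrier
  targetAt         (inj₁ _) = 0#
  targetAt         (inj₂ _) = 1#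

  -- This vector is the sum of the tensors of v with all indices, whatever v is.
  target : ∀ s D → Fin (s ℕ.* D ℕ.+ 1) → Carrier
  target s D l = targetAt {s} {D} (splitAt (s ℕ.* D) l)

  target-InCone : ∀ {s D} (v : Fin D → Carrier) → InCone (tensor {s} v) (target s D)
  target-InCone {s} {D} v = (λ _ → 1#) , (λ _ → 0≤1) , λ l → sum-tensors (splitAt (s ℕ.* D) l)
    where
    sum-tensors : ∀ l → targetAt {s} {D} l ≈ sum (λ j → 1# * tensorAt {s} v j l)
    sum-tensors (inj₁ q) = let p , k = remQuot {s} D q in sym (begin
      sum (λ j → 1# * ((δ j (suc p) - δ j zero) * v k))              ≈⟨ sum-cong (λ j →
        solve 3 (λ x y v → con (+ 1) :* ((x :- y) :* v) := x :* v :+ (:- con (+ 1)) :* (y :* v))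
          refl (δ j (suc p)) (δ j zero) (v k)) ⟩
      sum (λ j → δ j (suc p) * v k + - 1# * (δ j zero * v k))        ≈⟨
        sum-axpy (λ j → δ j (suc p) * v k) (λ j → δ j zero * v k) (- 1#) ⟩
      sum (λ j → δ j (suc p) * v k) + - 1# * sum (λ j → δ {suc s} j zero * v k) ≈⟨
        +-cong (sum-δ (suc p) (λ _ → v k)) (*-congˡ (sum-δ {suc s} zero (λ _ → v k))) ⟩
      v k + - 1# * v k                                               ≈⟨
        solve 1 (λ v → v :+ (:- con (+ 1)) :* v := con (+ 0)) refl (v k) ⟩
      0#                                                             ∎)
    sum-tensors (inj₂ _) = sym (trans
      (sum-cong (λ j → *-comm 1# (δ {suc s} j zero))) (sum-δ {suc s} zero (λ _ → 1#)))

  -- The sum of w i · v i over the indices i with φ i = p.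
  part : ∀ {m s D} → (Fin m → Carrier) → (Fin m → Fin D → Carrier) →
         (Fin m → Fin s) → Fin s → Fin D → Carrier
  part w v φ p = lin (λ i → w i * δ (φ i) p) v

  -- If a combination of tensors of the v i with indices φ i equals the target,
  -- then the sums over the classes of φ are all equal, because
  -- e₀ + … + eₛ = 0 is essentially the only relation.
  part-equal : ∀ {m s D} (w : Fin m → Carrier) (v : Fin m → Fin D → Carrier)
    (φ : Fin m → Fin (suc s)) → (∀ l → target s D l ≈ lin w (λ i → tensor (v i) (φ i)) l) →
    ∀ p k → part w v φ p k ≈ part w v φ zero k
  part-equal w v φ eq zero    k = refl
  part-equal {s = s} {D} w v φ eq (suc p) k = begin
    part w v φ (suc p) k                                       ≈⟨ sum-cong (λ i →
      solve 4 (λ w x y v → w :* x :* v := w :* ((x :- y) :* v) :+ con (+ 1) :* (w :* y :* v))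
        refl (w i) (δ (φ i) (suc p)) (δ (φ i) zero) (v i k)) ⟩
    sum (λ i → w i * ((δ (φ i) (suc p) - δ (φ i) zero) * v i k) + 1# * (w i * δ (φ i) zero * v i k))
                                                               ≈⟨
      sum-axpy (λ i → w i * ((δ (φ i) (suc p) - δ (φ i) zero) * v i k))
               (λ i → w i * δ (φ i) zero * v i k) 1# ⟩
    sum (λ i → w i * ((δ (φ i) (suc p) - δ (φ i) zero) * v i k)) + 1# * part w v φ zero k
                                                               ≈⟨ +-cong (sym difference) (*-identityˡ _) ⟩
    0# + part w v φ zero k                                     ≈⟨ +-identityˡ _ ⟩
    part w v φ zero k                                          ∎
    where
    l : Fin (s ℕ.* D ℕ.+ 1)
    l = combine p k ↑ˡ 1
    coordinate : splitAt (s ℕ.* D) l ≡ inj₁ (combine p k)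
    coordinate = Fin.splitAt-↑ˡ (s ℕ.* D) (combine p k) 1
    difference : 0# ≈ sum (λ i → w i * ((δ (φ i) (suc p) - δ (φ i) zero) * v i k))
    difference = trans (reflexive (≡.sym (≡.cong (targetAt {s} {D}) coordinate)))
      (trans (eq l) (sum-cong (λ i → *-congˡ {w i} (reflexive (≡.trans
        (≡.cong (tensorAt {s} (v i) (φ i)) coordinate)
        (≡.cong (λ (p , k) → (δ (φ i) (suc p) - δ (φ i) zero) * v i k) (Fin.remQuot-combine p k)))))))

  -- The further coordinate normalises the total weight of the class of 0.
  part-total : ∀ {m s D} (w : Fin m → Carrier) (v : Fin m → Fin D → Carrier)
    (φ : Fin m → Fin (suc s)) → (∀ l → target s D l ≈ lin w (λ i → tensor (v i) (φ i)) l) →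
    sum (λ i → w i * δ (φ i) zero) ≈ 1#
  part-total {s = s} {D} w v φ eq = sym (trans
    (reflexive (≡.sym (≡.cong (targetAt {s} {D}) coordinate)))
    (trans (eq l) (sum-cong (λ i → *-congˡ {w i}
      (reflexive (≡.cong (tensorAt {s} (v i) (φ i)) coordinate))))))
    where
    l : Fin (s ℕ.* D ℕ.+ 1)
    l = (s ℕ.* D) ↑ʳ zero
    coordinate : splitAt (s ℕ.* D) l ≡ inj₂ zero
    coordinate = Fin.splitAt-↑ʳ (s ℕ.* D) 1 zero

  -- The point x with a coordinate 1 appended.
  homogenize : ∀ {d} → (Fin d → Carrier) → Fin (d ℕ.+ 1) → Carrier
  homogenize {d} x k = [ x , (λ _ → 1#) ]′ (splitAt d k)

  -- Every point a i gets a class φ i and a weight w i in such a way that each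
  -- class has total weight 1 and all classes have the same weighted sum.
  balanced-colouring : ∀ s {d} (a : Fin (s ℕ.* (d ℕ.+ 1) ℕ.+ 1) → Fin d → Carrier) →
    Σ[ φ ∈ (Fin (s ℕ.* (d ℕ.+ 1) ℕ.+ 1) → Fin (suc s)) ] ∃[ w ] NonNegative w ×
      (∀ p → sum (λ i → w i * δ (φ i) p) ≈ 1#) ×
      (∀ p k → part w a φ p k ≈ part w a φ zero k)
  balanced-colouring s {d} a =
    let φ , w , 0≤w , eq = colourful (λ i → tensor (v i)) (target s (d ℕ.+ 1)) (λ i → target-InCone (v i))
    in  lookup φ , w , 0≤w
      , (λ p → trans (weights w (lookup φ) p)
          (trans (part-equal w v (lookup φ) eq p (d ↑ʳ zero))
            (trans (sym (weights w (lookup φ) zero)) (part-total w v (lookup φ) eq))))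
      , (λ p k → trans (points w (lookup φ) p k)
          (trans (part-equal w v (lookup φ) eq p (k ↑ˡ 1)) (sym (points w (lookup φ) zero k))))
    where
    v : Fin (s ℕ.* (d ℕ.+ 1) ℕ.+ 1) → Fin (d ℕ.+ 1) → Carrier
    v i = homogenize (a i)
    weights : ∀ w φ p → sum (λ i → w i * δ (φ i) p) ≈ part {s = suc s} w v φ p (d ↑ʳ zero)
    weights w φ p = sum-cong λ i → sym (trans
      (*-congˡ (reflexive (≡.cong [ a i , (λ _ → 1#) ]′ (Fin.splitAt-↑ʳ d 1 zero)))) (*-identityʳ _))
    points : ∀ w φ p k → part w a φ p k ≈ part {s = suc s} w v φ p (k ↑ˡ 1)
    points w φ p k = sum-cong λ i → *-congˡ {w i * δ (φ i) p}
      (reflexive (≡.sym (≡.cong [ a i , (λ _ → 1#) ]′ (Fin.splitAt-↑ˡ d k 1))))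

  open Euclidean ℝ

  tverberg : ∀ s {d} (a : Fin (s ℕ.* (d ℕ.+ 1) ℕ.+ 1) → Point d) →
             (∀ {i j} → a i ≋ a j → i ≡ j) → Divisible (suc s) (Range a)
  tverberg s {d} a injective =
    let φ , w , 0≤w , total≈1 , equal = balanced-colouring s a in
    class φ , isPartition φ , part w a φ zero ,
    λ p → common φ w 0≤w p (total≈1 p) (λ k → sym (equal p k))
    where
    n = s ℕ.* (d ℕ.+ 1) ℕ.+ 1

    -- The set of the points a i with φ i = p.
    class : (Fin n → Fin (suc s)) → Fin (suc s) → Point d → Set ℓ₁
    class φ p x = ∃[ i ] φ i ≡ p × x ≋ a i

    isPartition : ∀ φ → IsPartition (Range a) (class φ)
    isPartition φ = record
      { respects = λ p x≋y (i , φi≡p , x≋aᵢ) → i , φi≡p , λ k → trans (sym (x≋y k)) (x≋aᵢ k)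
      ; disjoint = λ p q p≢q ((i , φi≡p , x≋aᵢ) , (j , φj≡q , x≋aⱼ)) → p≢q
          (≡.trans (≡.sym φi≡p) (≡.trans
            (≡.cong φ (injective (λ k → trans (sym (x≋aᵢ k)) (x≋aⱼ k)))) φj≡q))
      ; union = (λ (i , x≋aᵢ) → φ i , i , ≡.refl , x≋aᵢ) , λ (p , i , _ , x≋aᵢ) → i , x≋aᵢ
      }

    inhabited : ∀ φ w p → sum (λ i → w i * δ (φ i) p) ≈ 1# → ∃[ i ] φ i ≡ p
    inhabited φ w p total≈1 with Fin.any? (λ i → φ i Fin.≟ p)
    ... | yes found = found
    ... | no  none  = contradiction (trans (sym (sum-0 (λ i →
      trans (*-congˡ (δ-≢ (λ φi≡p → none (i , φi≡p)))) (zeroʳ (w i))))) total≈1) 0≉1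

    common : ∀ φ w → NonNegative w → ∀ p → sum (λ i → w i * δ (φ i) p) ≈ 1# →
             ∀ {z} → z ≋ part w a φ p → conv (class φ p) z
    common φ w 0≤w p total≈1 z≋ =
      n , y , (λ i → w i * δ (φ i) p) , y∈class ,
      (λ i → *-nonNegative (0≤w i) (δ-nonNegative (φ i) p)) , total≈1 ,
      λ k → trans (z≋ k) (sum-cong (λ i → term i k))
      where
      witness = inhabited φ w p total≈1
      -- A convex combination may only name points of the class p, so the points
      -- of other classes, which have weight 0, are replaced by a fixed one of p.
      choose : ∀ i → Dec (φ i ≡ p) → Fin n
      choose i (yes _) = i
      choose i (no _)  = proj₁ witness
      y : Fin n → Point d
      y i = a (choose i (φ i Fin.≟ p))
      y∈class : ∀ i → class φ p (y i)
      y∈class i with φ i Fin.≟ p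
      ... | yes φi≡p = i , φi≡p , λ _ → refl
      ... | no  _    = proj₁ witness , proj₂ witness , λ _ → refl
      term : ∀ i k → w i * δ (φ i) p * a i k ≈ w i * δ (φ i) p * y i k
      term i k with φ i Fin.≟ p
      ... | yes _    = refl
      ... | no  φi≢p = trans (vanish (a i k)) (sym (vanish (a (proj₁ witness) k)))
        where
        vanish : ∀ x → w i * δ (φ i) p * x ≈ 0#
        vanish x = trans (*-congʳ (trans (*-congˡ (δ-≢ φi≢p)) (zeroʳ (w i)))) (zeroˡ x)

open import Data.Nat.Base using (ℕ; _+_; _*_; _∸_; _≥_)
open import Function.Definitions using (Injective)

theorem1p1 : ∀ {c ℓ₁ ℓ₂} (ℝ : RealNumbers c ℓ₁ ℓ₂) → let open Euclidean ℝ in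
    (r d n : ℕ) → r ≥ 2 → d ≥ 1 → n ≡ (r ∸ 1) * (d + 1) + 1 →
    (a : Fin n → Point d) → Injective _≡_ _≋_ a →
    Divisible r (Range a)
theorem1p1 ℝ (suc s) d n _ _ ≡.refl a injective = Tverberg.tverberg ℝ s a injective
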